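{- For every integer $n\ge 1$, $$\mathcal{N}_{[n]\times[n]}(x)=\mathrm{Cat}(B_n,x)\qquad\text{and}\qquad \mathcal{N}_{[2n+1]\times K_n}(x)=\mathrm{Cat}(D_{2n+2},x).$$
   Context: $[m]$ denotes the chain with $m$ elements, and products of posets carry the componentwise order. $K_n=[n]\oplus([1]\sqcup[1])\oplus[n]$, where $\sqcup$ is disjoint union and $\oplus$ is ordinal sum (in $R\oplus S$ every element of $R$ is below every element of $S$). For a finite poset $R$, $\mathcal{N}_R(x):=\sum_A x^{|A|}$, where $A$ runs over all antichains of $R$ (including the empty one). $\mathrm{Cat}(B_n,x)$ and $\mathrm{Cat}(D_N,x)$ are the Narayana polynomials of types $B_n$ and $D_N$, given explicitly by $$\mathrm{Cat}(B_n,x)=\sum_{i=0}^n\binom{n}{i}^2x^i,\qquad \mathrm{Cat}(D_N,x)=\sum_{i=0}^{N}\binom{N}{i}\left(\binom{N-1}{i}+\binom{N-2}{i-2}\right)x^i,$$ where binomial coefficients $\binom{a}{b}$ with $b<0$ or $b>a$ are $0$. -}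

module Defs where

open import Data.Fin.Base using (Fin)
import Data.Fin.Properties as Fin
open import Data.Fin.Subset using (Subset; inside; outside; _∈_; ∣_∣)
open import Data.Fin.Subset.Properties using (_∈?_)
open import Data.Integer.Base using (ℤ; +_; -[1+_]; _⊖_)
open import Data.List.Base as List using (List; []; _∷_; _++_; filter; upTo)
open import Data.Nat.Base using (ℕ; zero; suc; _+_; _*_; _^_; _∸_)
open import Data.Nat.Combinatorics using (_C_)
open import Data.Product.Function.NonDependent.Setoid using (_×-inverse_)
import Data.Product.Relation.Binary.Pointwise.NonDependent as ×
open import Data.Sum.Function.Setoid using (_⊎-inverse_)
import Data.Sum.Relation.Binary.LeftOrder as Left
import Data.Sum.Relation.Binary.Pointwise as ⊎
open import Data.Vec.Base as Vec using ()
open import Function.Bundles using (Inverse)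
open import Function.Construct.Composition using () renaming (inverse to _⟫_)
open import Function.Construct.Identity using () renaming (inverse to idInverse)
open import Function.Construct.Symmetry using () renaming (inverse to symInverse)
open import Level using (0ℓ)
open import Relation.Binary.Bundles using (Poset)
open import Relation.Binary.Definitions using (Decidable)
open import Relation.Binary.PropositionalEquality using (_≡_; _≢_; setoid)
open import Relation.Nullary.Decidable using (Dec; ¬?; _→-dec_)
open import Relation.Nullary.Negation using (¬_)

-- The enumeration is a bijection up to the setoid equality of the poset.
record FinPoset : Set₁ where
  field
    poset : Poset 0ℓ 0ℓ 0ℓ
  open Poset poset public using (Carrier; _≤_; module Eq)
  field
    _≤?_ : Decidable _≤_
    size : ℕ
    enum : Inverse (setoid (Fin size)) Eq.setoid

  element : Fin size → Carrier
  element = Inverse.to enum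

chain : ℕ → FinPoset
chain m = record
  { poset = Fin.≤-poset m
  ; _≤?_  = Fin._≤?_
  ; size  = m
  ; enum  = idInverse _
  }

infixr 7 _⊗_
infixr 6 _⊔_
infixr 5 _⊕_

_⊗_ : FinPoset → FinPoset → FinPoset
R ⊗ S = record
  { poset = ×.×-poset R.poset S.poset
  ; _≤?_  = ×.×-decidable R._≤?_ S._≤?_
  ; size  = R.size * S.size
  ; enum  = (Fin.*↔× ⟫ symInverse ×.Pointwise-≡↔≡) ⟫ (R.enum ×-inverse S.enum)
  } where module R = FinPoset R; module S = FinPoset S

_⊔_ : FinPoset → FinPoset → FinPoset
R ⊔ S = record
  { poset = ⊎.⊎-poset R.poset S.poset
  ; _≤?_  = ⊎.⊎-decidable R._≤?_ S._≤?_
  ; size  = R.size + S.size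
  ; enum  = (Fin.+↔⊎ ⟫ symInverse (⊎.Pointwise-≡↔≡ _ _)) ⟫ (R.enum ⊎-inverse S.enum)
  } where module R = FinPoset R; module S = FinPoset S

-- Left.₁∼₂ puts every element of R below every element of S.  The levels
-- d, e, f do not occur in the type of ⊎-<-poset, so they cannot be inferred.
_⊕_ : FinPoset → FinPoset → FinPoset
R ⊕ S = record
  { poset = Left.⊎-<-poset {d = 0ℓ} {e = 0ℓ} {f = 0ℓ} R.poset S.poset
  ; _≤?_  = Left.⊎-<-decidable R._≤?_ S._≤?_
  ; size  = R.size + S.size
  ; enum  = (Fin.+↔⊎ ⟫ symInverse (⊎.Pointwise-≡↔≡ _ _)) ⟫ (R.enum ⊎-inverse S.enum)
  } where module R = FinPoset R; module S = FinPoset S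

K : ℕ → FinPoset
K n = chain n ⊕ (chain 1 ⊔ chain 1) ⊕ chain n

module _ (R : FinPoset) where
  open FinPoset R

  -- Subsets are subsets of the index set Fin size; distinct indices are
  -- distinct elements because enum is injective.  Incomparability is
  -- obtained by taking the pair (i , j) in both orders.
  IsAntichain : Subset size → Set
  IsAntichain A = ∀ i j → i ∈ A → j ∈ A → i ≢ j → ¬ (element i ≤ element j)

  isAntichain? : (A : Subset size) → Dec (IsAntichain A)
  isAntichain? A = Fin.all? λ i → Fin.all? λ j →
    (i ∈? A) →-dec (j ∈? A) →-dec ¬? (i Fin.≟ j) →-dec ¬? (element i ≤? element j)

-- Every subset of Fin n, exactly once.
allSubsets : ∀ n → List (Subset n)
allSubsets zero    = Vec.[] ∷ []
allSubsets (suc n) =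
  List.map (outside Vec.∷_) (allSubsets n) ++ List.map (inside Vec.∷_) (allSubsets n)

antichains : (R : FinPoset) → List (Subset (FinPoset.size R))
antichains R = filter (isAntichain? R) (allSubsets (FinPoset.size R))

-- Polynomials over ℕ as coefficient lists, constant term first; trailing zeros are allowed, so
-- equality of polynomials is _≈ₚ_ and not _≡_.
Poly : Set
Poly = List ℕ

coeff : Poly → ℕ → ℕ
coeff []      _       = 0
coeff (c ∷ _) zero    = c
coeff (_ ∷ p) (suc i) = coeff p i

infix 4 _≈ₚ_

_≈ₚ_ : Poly → Poly → Set
p ≈ₚ q = ∀ i → coeff p i ≡ coeff q i

infixl 6 _+ₚ_
infix  8 _·x^_

_+ₚ_ : Poly → Poly → Poly
[]      +ₚ q       = q
(c ∷ p) +ₚ []      = c ∷ p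
(c ∷ p) +ₚ (d ∷ q) = (c + d) ∷ (p +ₚ q)

_·x^_ : ℕ → ℕ → Poly
c ·x^ zero  = c ∷ []
c ·x^ suc k = 0 ∷ (c ·x^ k)

∑ : ∀ {a} {A : Set a} → List A → (A → Poly) → Poly
∑ as f = List.foldr (λ a p → f a +ₚ p) [] as

𝒩 : FinPoset → Poly
𝒩 R = ∑ (antichains R) λ A → 1 ·x^ ∣ A ∣

-- _C_ is already 0 when the lower index exceeds the upper one.
binom : ℕ → ℤ → ℕ
binom a (+ b)    = a C b
binom a -[1+ _ ] = 0

CatB : ℕ → Poly
CatB n = ∑ (upTo (suc n)) λ i → ((n C i) ^ 2) ·x^ i

-- i ⊖ 2 is the integer i - 2.  Type D_N requires N ≥ 2, so that the
-- truncated subtractions N ∸ 1 and N ∸ 2 are genuine.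
CatD : ℕ → Poly
CatD N = ∑ (upTo (suc N)) λ i →
  ((N C i) * ((N ∸ 1) C i + binom (N ∸ 2) (i ⊖ 2))) ·x^ i

{-# OPTIONS --safe #-}

-- Antichains of [m] × R are counted row by row.  Choosing (a , x) in the lowest row of the
-- product forbids, in all later rows, exactly the elements above x, so the number of antichains
-- of [m] × R depends on the down set U of R that is still allowed, and satisfies a recursion in
-- m over the antichains of R inside U.  For R a chain with |U| = u the solution is C(m,i) C(u,i).
-- For R = K_n it is C(m,i) C(|U|,i), plus C(m+1,i) C(|U|-2,i-2) when U contains both incomparable
-- elements; the sums over chains in the recursion telescope by Pascal's rule.

module Submission where

open import Defs
open import Data.Bool.Base using (Bool; true; false; not; _∧_; if_then_else_)
open import Data.Bool.Properties using (∧-zeroʳ; ∧-identityʳ)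
open import Data.Fin.Base as Fin using (Fin; zero; suc; toℕ; _↑ˡ_; _↑ʳ_)
import Data.Fin.Properties as Fin
open import Data.Fin.Subset using (Subset; inside; outside; _∈_; ∣_∣)
open import Data.Integer.Base using (_⊖_)
open import Data.List.Base as List using (List; []; _∷_; _++_; filter; tabulate; upTo; applyUpTo)
open import Data.List.Properties using (map-++; map-∘; map-tabulate; map-upTo; tabulate-cong; filter-++; filter-none; ++-assoc; ++-identityʳ)
open import Data.List.Relation.Unary.All as All using (All; []; _∷_)
import Data.List.Relation.Unary.All.Properties as All
open import Data.Nat.Base using (ℕ; zero; suc; _≤_; _<_; _+_; _*_; _^_; _∸_; z≤n; s≤s; _<ᵇ_; _≤ᵇ_)
open import Data.Nat.Combinatorics using (_C_; nCk+nC[k+1]≡[n+1]C[k+1]; k>n⇒nCk≡0)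
open import Data.Nat.ListAction using (sum)
open import Data.Nat.ListAction.Properties using (sum-++)
open import Data.Nat.Properties using (+-identityʳ; *-zeroʳ; *-identityʳ; ≤-refl)
open import Data.Nat.Tactic.RingSolver using (solve-∀)
open import Data.Product.Base using (_×_; _,_; proj₁; proj₂; map₁)
open import Data.Sum.Base as Sum using (inj₁; inj₂)
open import Data.Vec.Base as Vec using (here; there)
open import Function.Base using (_∘_; id; const)
open import Function.Bundles using (_⇔_; mk⇔; Equivalence)
open import Function.Construct.Composition using (_⇔-∘_)
open import Level using (0ℓ)
open import Relation.Binary.PropositionalEquality using (_≡_; _≢_; _≗_; refl; sym; trans; cong; cong₂; module ≡-Reasoning)
open import Relation.Nullary.Decidable using (does; yes; no; dec-true; dec-false)
open import Relation.Nullary.Negation using (contradiction)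
open import Relation.Unary using (Pred; Decidable)

-- Coefficient sequences and conditional sums

private variable
  A B : Set

-- Multiplication by `x`, for polynomials given by their coefficient functions.
shift : (ℕ → ℕ) → ℕ → ℕ
shift f zero    = 0
shift f (suc i) = f i

shift-cong : ∀ {f g} → f ≗ g → shift f ≗ shift g
shift-cong f≗g zero    = refl
shift-cong f≗g (suc i) = f≗g i

if-cong : ∀ b {x y : A} {z} → (b ≡ true → x ≡ y) → (if b then x else z) ≡ (if b then y else z)
if-cong true  x≡y = x≡y refl
if-cong false _   = refl

shift-+ : ∀ f g i → shift (λ j → f j + g j) i ≡ shift f i + shift g i
shift-+ f g zero    = refl
shift-+ f g (suc i) = refl

shift-* : ∀ f g i → shift (λ j → f j * g j) i ≡ shift f i * shift g i
shift-* f g zero    = refl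
shift-* f g (suc i) = refl

∑where : ∀ n → (Fin n → Bool) → (Fin n → ℕ) → ℕ
∑where zero    b f = 0
∑where (suc n) b f = (if b zero then f zero else 0) + ∑where n (b ∘ suc) (f ∘ suc)

-- The hypothesis may use `b c ≡ true`, since later on the summands simplify only for indices `c`
-- inside the current down set.
∑where-cong : ∀ n b {f g} → (∀ c → b c ≡ true → f c ≡ g c) → ∑where n b f ≡ ∑where n b g
∑where-cong zero    b f≡g = refl
∑where-cong (suc n) b f≡g = cong₂ _+_ (if-cong (b zero) (f≡g zero)) (∑where-cong n (b ∘ suc) (f≡g ∘ suc))

-- Counting antichains by deletion and contraction

incomparable : (A → A → Bool) → A → A → Bool
incomparable _≼_ x y = not (x ≼ y) ∧ not (y ≼ x)

-- The coefficient at `i` of the antichain polynomial of the listed elements satisfying `P`. The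
-- list is never filtered: restrictions imposed by chosen elements accumulate in `P`.
count : (A → A → Bool) → (A → Bool) → List A → ℕ → ℕ
count _≼_ P []       zero    = 1
count _≼_ P []       (suc _) = 0
count _≼_ P (x ∷ xs) i =
  count _≼_ P xs i +
  (if P x then shift (count _≼_ (λ y → P y ∧ incomparable _≼_ x y) xs) i else 0)

count-cong : ∀ {_≼_ _⊑_ : A → A → Bool} {P Q} → (∀ x y → (x ≼ y) ≡ (x ⊑ y)) → P ≗ Q →
             ∀ xs → count _≼_ P xs ≗ count _⊑_ Q xs
count-cong ≼≗⊑ P≗Q []       zero    = refl
count-cong ≼≗⊑ P≗Q []       (suc i) = refl
count-cong {P = P} ≼≗⊑ P≗Q (x ∷ xs) i rewrite sym (P≗Q x) =
  cong₂ _+_ (count-cong ≼≗⊑ P≗Q xs i)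
    (if-cong (P x) λ _ → shift-cong (count-cong ≼≗⊑
      (λ y → cong₂ _∧_ (P≗Q y) (cong₂ _∧_ (cong not (≼≗⊑ x y)) (cong not (≼≗⊑ y x)))) xs) i)

count-map : ∀ (_≼_ : B → B → Bool) P (f : A → B) xs →
            count _≼_ P (List.map f xs) ≗ count (λ x y → f x ≼ f y) (P ∘ f) xs
count-map _≼_ P f []       zero    = refl
count-map _≼_ P f []       (suc i) = refl
count-map _≼_ P f (x ∷ xs) i =
  cong₂ _+_ (count-map _≼_ P f xs i)
    (if-cong (P (f x)) λ _ → shift-cong (count-map _≼_ _ f xs) i)

count-skip : ∀ (_≼_ : A → A → Bool) P {xs} ys → All (λ x → P x ≡ false) xs →
             count _≼_ P (xs ++ ys) ≗ count _≼_ P ys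
count-skip _≼_ P ys []         i = refl
count-skip _≼_ P ys (Px ∷ Pxs) i rewrite Px = trans (+-identityʳ _) (count-skip _≼_ P ys Pxs i)

∧-falseʳ : ∀ a {b} → b ≡ false → a ∧ b ≡ false
∧-falseʳ a refl = ∧-zeroʳ a

-- An antichain contains at most one element of a chain, so either no `e c` is chosen or exactly
-- one, after which only `ys` remains to be decided.
count-chain : ∀ (_≼_ : A → A → Bool) P {l} (e : Fin l → A) ys i →
  (∀ {c d} → c Fin.< d → (e c ≼ e d) ≡ true) →
  count _≼_ P (tabulate e ++ ys) i ≡
  count _≼_ P ys i +
  ∑where l (λ c → P (e c)) (λ c → shift (count _≼_ (λ y → P y ∧ incomparable _≼_ (e c) y) ys) i)
count-chain _≼_ P {zero}  e ys i increasing = sym (+-identityʳ _)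
count-chain {A = A} _≼_ P {suc l} e ys i increasing = begin
  count _≼_ P (tabulate e′ ++ ys) i + first (tabulate e′ ++ ys)
    ≡⟨ cong₂ _+_ (count-chain _≼_ P e′ ys i (increasing ∘ s≤s))
         -- Once `e zero` is chosen, the rest of the chain lies above it and is skipped.
         (if-cong (P (e zero)) λ _ → shift-cong (count-skip _≼_ _ ys (All.tabulate⁺ λ c →
           ∧-falseʳ (P (e′ c)) (cong (λ b → not b ∧ not (e′ c ≼ e zero)) (increasing (s≤s z≤n))))) i) ⟩
  (count _≼_ P ys i + others) + first ys
    ≡⟨ rearrange (count _≼_ P ys i) others (first ys) ⟩
  count _≼_ P ys i + (first ys + others) ∎
  where
  open ≡-Reasoning
  e′ : Fin l → A
  e′ = e ∘ suc
  first : List A → ℕ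
  first zs = if P (e zero) then shift (count _≼_ (λ y → P y ∧ incomparable _≼_ (e zero) y) zs) i else 0
  others : ℕ
  others = ∑where l (λ c → P (e′ c)) (λ c → shift (count _≼_ (λ y → P y ∧ incomparable _≼_ (e′ c) y) ys) i)
  rearrange : ∀ a b c → (a + b) + c ≡ a + (c + b)
  rearrange = solve-∀

-- Coefficients of 𝒩

coeff-+ₚ : ∀ p q i → coeff (p +ₚ q) i ≡ coeff p i + coeff q i
coeff-+ₚ []      q       i       = refl
coeff-+ₚ (c ∷ p) []      i       = sym (+-identityʳ _)
coeff-+ₚ (c ∷ p) (d ∷ q) zero    = refl
coeff-+ₚ (c ∷ p) (d ∷ q) (suc i) = coeff-+ₚ p q i

coeff-∑ : ∀ (as : List A) f i → coeff (∑ as f) i ≡ sum (List.map (λ a → coeff (f a) i) as)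
coeff-∑ []       f i = refl
coeff-∑ (a ∷ as) f i = trans (coeff-+ₚ (f a) _ i) (cong (coeff (f a) i +_) (coeff-∑ as f i))

filter-map : ∀ {P : Pred B 0ℓ} (P? : Decidable P) (f : A → B) xs →
             filter P? (List.map f xs) ≡ List.map f (filter (P? ∘ f) xs)
filter-map P? f []       = refl
filter-map P? f (x ∷ xs) with ih ← filter-map P? f xs | does (P? (f x))
... | true  = cong (f x ∷_) ih
... | false = ih

countSubsets : ∀ {n} → List (Subset n) → ℕ → ℕ
countSubsets As i = sum (List.map (λ A → coeff (1 ·x^ ∣ A ∣) i) As)

countSubsets-++ : ∀ {n} (As Bs : List (Subset n)) i →
                  countSubsets (As ++ Bs) i ≡ countSubsets As i + countSubsets Bs i
countSubsets-++ As Bs i = trans (cong sum (map-++ _ As Bs)) (sum-++ (List.map _ As) _)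

countSubsets-outside : ∀ {n} (As : List (Subset n)) →
                       countSubsets (List.map (outside Vec.∷_) As) ≗ countSubsets As
countSubsets-outside As i = cong sum (sym (map-∘ As))

-- Each set gains one element, which multiplies its monomial by `x`.
countSubsets-inside : ∀ {n} (As : List (Subset n)) →
                      countSubsets (List.map (inside Vec.∷_) As) ≗ shift (countSubsets As)
countSubsets-inside []       zero    = refl
countSubsets-inside (A ∷ As) zero    = countSubsets-inside As zero
countSubsets-inside As       (suc i) = cong sum (sym (map-∘ As))

-- The index sets that `count` enumerates. The predicate `P` makes induction on `n` possible,
-- because it can record incomparability with the elements already chosen.
Admissible : (A → A → Bool) → (A → Bool) → ∀ {n} → (Fin n → A) → Subset n → Set
Admissible _≼_ P e S =
  (∀ i → i ∈ S → P (e i) ≡ true) ×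
  (∀ i j → i ∈ S → j ∈ S → i ≢ j → (e i ≼ e j) ≡ false)

module _ (_≼_ : A → A → Bool) (P : A → Bool) {n} (e : Fin (suc n) → A) (S : Subset n) where

  private
    P′ : A → Bool
    P′ y = P y ∧ incomparable _≼_ (e zero) y

  admissible-outside : Admissible _≼_ P e (outside Vec.∷ S) ⇔ Admissible _≼_ P (e ∘ suc) S
  admissible-outside = mk⇔
    (λ (all , anti) → (λ i i∈ → all (suc i) (there i∈)) ,
                      (λ i j i∈ j∈ i≢j → anti (suc i) (suc j) (there i∈) (there j∈) (i≢j ∘ Fin.suc-injective)))
    (λ (all , anti) → (λ { (suc i) (there i∈) → all i i∈ }) ,
                      (λ { (suc i) (suc j) (there i∈) (there j∈) i≢j → anti i j i∈ j∈ (i≢j ∘ cong suc) }))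

  -- The pairwise conditions that involve index `zero` become the pointwise condition `P′` on the
  -- remaining indices.
  admissible-inside⁺ : P (e zero) ≡ true → Admissible _≼_ P′ (e ∘ suc) S →
                       Admissible _≼_ P e (inside Vec.∷ S)
  admissible-inside⁺ P₀ (all , anti) =
    (λ { zero    _          → P₀
       ; (suc i) (there i∈) → proj₁ (all′ i i∈) }) ,
    (λ { zero    zero    _          _          0≢0 → contradiction refl 0≢0
       ; zero    (suc j) _          (there j∈) _   → proj₁ (proj₂ (all′ j j∈))
       ; (suc i) zero    (there i∈) _          _   → proj₂ (proj₂ (all′ i i∈))
       ; (suc i) (suc j) (there i∈) (there j∈) i≢j → anti i j i∈ j∈ (i≢j ∘ cong suc) })
    where
    split : ∀ a b c → a ∧ (not b ∧ not c) ≡ true → a ≡ true × b ≡ false × c ≡ false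
    split true false false refl = refl , refl , refl
    all′ : ∀ i → i ∈ S → P (e (suc i)) ≡ true × (e zero ≼ e (suc i)) ≡ false × (e (suc i) ≼ e zero) ≡ false
    all′ i i∈ = split (P (e (suc i))) (e zero ≼ e (suc i)) (e (suc i) ≼ e zero) (all i i∈)

  admissible-inside⁻ : Admissible _≼_ P e (inside Vec.∷ S) → Admissible _≼_ P′ (e ∘ suc) S
  admissible-inside⁻ (all , anti) =
    (λ i i∈ → join (P (e (suc i))) (e zero ≼ e (suc i)) (e (suc i) ≼ e zero)
                   (all (suc i) (there i∈))
                   (anti zero (suc i) here (there i∈) λ ())
                   (anti (suc i) zero (there i∈) here λ ())) ,
    (λ i j i∈ j∈ i≢j → anti (suc i) (suc j) (there i∈) (there j∈) (i≢j ∘ Fin.suc-injective))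
    where
    join : ∀ a b c → a ≡ true → b ≡ false → c ≡ false → a ∧ (not b ∧ not c) ≡ true
    join _ _ _ refl refl refl = refl

-- The recursion of `allSubsets` on the first entry matches deletion and contraction in `count`. Any
-- decidable `Q` equivalent to admissibility is allowed, so that in the induction `Q?` is merely
-- precomposed with the choice of the first entry.
countSubsets-admissible : ∀ (_≼_ : A → A → Bool) P {n} (e : Fin n → A)
  {Q : Pred (Subset n) 0ℓ} (Q? : Decidable Q) →
  (∀ S → Q S ⇔ Admissible _≼_ P e S) →
  countSubsets (filter Q? (allSubsets n)) ≗ count _≼_ P (tabulate e)
countSubsets-admissible _≼_ P {zero} e Q? Q⇔ i with Q? Vec.[]
... | no ¬Q = contradiction (Equivalence.from (Q⇔ Vec.[]) ((λ ()) , (λ ()))) ¬Q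
countSubsets-admissible _≼_ P {zero} e Q? Q⇔ zero    | yes _ = refl
countSubsets-admissible _≼_ P {zero} e Q? Q⇔ (suc i) | yes _ = refl
countSubsets-admissible {A = A} _≼_ P {suc n} e {Q} Q? Q⇔ i = begin
  countSubsets (filter Q? (outs ++ ins)) i
    ≡⟨ cong (λ As → countSubsets As i) (filter-++ Q? outs ins) ⟩
  countSubsets (filter Q? outs ++ filter Q? ins) i
    ≡⟨ countSubsets-++ (filter Q? outs) (filter Q? ins) i ⟩
  countSubsets (filter Q? outs) i + countSubsets (filter Q? ins) i
    ≡⟨ cong₂ _+_ outs-count (ins-count (P (e zero)) refl) ⟩
  count _≼_ P (tabulate e) i ∎
  where
  open ≡-Reasoning
  outs ins : List (Subset (suc n))
  outs = List.map (outside Vec.∷_) (allSubsets n)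
  ins  = List.map (inside Vec.∷_) (allSubsets n)
  P′ : A → Bool
  P′ y = P y ∧ incomparable _≼_ (e zero) y
  outs-count : countSubsets (filter Q? outs) i ≡ count _≼_ P (tabulate (e ∘ suc)) i
  outs-count = begin
    countSubsets (filter Q? outs) i
      ≡⟨ cong (λ As → countSubsets As i) (filter-map Q? _ (allSubsets n)) ⟩
    countSubsets (List.map (outside Vec.∷_) (filter (Q? ∘ (outside Vec.∷_)) (allSubsets n))) i
      ≡⟨ countSubsets-outside (filter _ (allSubsets n)) i ⟩
    countSubsets (filter (Q? ∘ (outside Vec.∷_)) (allSubsets n)) i
      ≡⟨ countSubsets-admissible _≼_ P (e ∘ suc) (Q? ∘ (outside Vec.∷_))
           (λ S → admissible-outside _≼_ P e S ⇔-∘ Q⇔ (outside Vec.∷ S)) i ⟩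
    count _≼_ P (tabulate (e ∘ suc)) i ∎
  ins-count : ∀ b → P (e zero) ≡ b → countSubsets (filter Q? ins) i ≡
              (if b then shift (count _≼_ P′ (tabulate (e ∘ suc))) i else 0)
  ins-count true P₀ = begin
    countSubsets (filter Q? ins) i
      ≡⟨ cong (λ As → countSubsets As i) (filter-map Q? _ (allSubsets n)) ⟩
    countSubsets (List.map (inside Vec.∷_) (filter (Q? ∘ (inside Vec.∷_)) (allSubsets n))) i
      ≡⟨ countSubsets-inside (filter _ (allSubsets n)) i ⟩
    shift (countSubsets (filter (Q? ∘ (inside Vec.∷_)) (allSubsets n))) i
      ≡⟨ shift-cong (countSubsets-admissible _≼_ P′ (e ∘ suc) (Q? ∘ (inside Vec.∷_)) λ S →
           mk⇔ (admissible-inside⁻ _≼_ P e S) (admissible-inside⁺ _≼_ P e S P₀)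
             ⇔-∘ Q⇔ (inside Vec.∷ S)) i ⟩
    shift (count _≼_ P′ (tabulate (e ∘ suc))) i ∎
  -- When `e zero` violates `P`, no admissible subset contains index `zero`.
  ins-count false ¬P₀ = cong (λ As → countSubsets As i) (filter-none Q? (All.map⁺ (All.universal
    (λ S QS → contradiction (trans (sym ¬P₀) (proj₁ (Equivalence.to (Q⇔ _) QS) zero here)) λ ())
    (allSubsets n))))

module _ (R : FinPoset) where
  open FinPoset R

  leq : Carrier → Carrier → Bool
  leq x y = does (x ≤? y)

  elements : List Carrier
  elements = tabulate element

  -- With no element forbidden at the start, admissibility is just the antichain condition.
  coeff-𝒩 : coeff (𝒩 R) ≗ count leq (const true) elements
  coeff-𝒩 i = trans (coeff-∑ (antichains R) _ i)
    (countSubsets-admissible leq (const true) element (isAntichain? R) (λ S → mk⇔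
      (λ anti → (λ _ _ → refl) ,
                (λ i j i∈ j∈ i≢j → dec-false (_ ≤? _) (anti i j i∈ j∈ i≢j)))
      (λ (_ , anti) i j i∈ j∈ i≢j i≤j →
         contradiction (trans (sym (anti i j i∈ j∈ i≢j)) (dec-true (_ ≤? _) i≤j)) λ ())) i)

-- Antichains in products with a chain

-- The Boolean test for `suc a ≤ suc b` unfolds to the left side; this arises when rows are
-- renumbered by `suc`.
<ᵇ-suc : ∀ a b → (a <ᵇ suc b) ≡ (a ≤ᵇ b)
<ᵇ-suc zero    b = refl
<ᵇ-suc (suc a) b = refl

tabulate-+ : ∀ m {n} (f : Fin (m + n) → A) →
             tabulate f ≡ tabulate (f ∘ (_↑ˡ n)) ++ tabulate (f ∘ (m ↑ʳ_))
tabulate-+ zero    f = refl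
tabulate-+ (suc m) f = cong (f zero ∷_) (tabulate-+ m (f ∘ suc))

elements-⊕ : ∀ R S → elements (R ⊕ S) ≡ List.map inj₁ (elements R) ++ List.map inj₂ (elements S)
elements-⊕ R S = begin
  tabulate (FinPoset.element (R ⊕ S))
    ≡⟨ tabulate-+ R.size _ ⟩
  tabulate (FinPoset.element (R ⊕ S) ∘ (_↑ˡ S.size)) ++ tabulate (FinPoset.element (R ⊕ S) ∘ (R.size ↑ʳ_))
    ≡⟨ cong₂ _++_
         (tabulate-cong λ i → cong (Sum.map R.element S.element) (Fin.splitAt-↑ˡ R.size i S.size))
         (tabulate-cong λ i → cong (Sum.map R.element S.element) (Fin.splitAt-↑ʳ R.size S.size i)) ⟩
  tabulate (inj₁ ∘ R.element) ++ tabulate (inj₂ ∘ S.element)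
    ≡⟨ cong₂ _++_ (map-tabulate R.element inj₁) (map-tabulate S.element inj₂) ⟨
  List.map inj₁ (elements R) ++ List.map inj₂ (elements S) ∎
  where
  open ≡-Reasoning
  module R = FinPoset R
  module S = FinPoset S

module _ (R : FinPoset) where
  open FinPoset R using (Carrier; element; size)

  -- The product is enumerated row by row, which lets `count` exhaust the lowest row before it
  -- reaches the others.
  elements-suc-⊗ : ∀ m → elements (chain (suc m) ⊗ R) ≡
    List.map (zero ,_) (elements R) ++ List.map (map₁ suc) (elements (chain m ⊗ R))
  elements-suc-⊗ m = begin
    tabulate e
      ≡⟨ tabulate-+ size e ⟩
    tabulate (e ∘ (_↑ˡ (m * size))) ++ tabulate (e ∘ (size ↑ʳ_))
      ≡⟨ cong₂ _++_ (tabulate-cong firstRow) (tabulate-cong laterRows) ⟩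
    tabulate ((zero ,_) ∘ element) ++ tabulate (map₁ suc ∘ FinPoset.element (chain m ⊗ R))
      ≡⟨ cong₂ _++_ (map-tabulate element _) (map-tabulate (FinPoset.element (chain m ⊗ R)) _) ⟨
    List.map (zero ,_) (elements R) ++ List.map (map₁ suc) (elements (chain m ⊗ R)) ∎
    where
    open ≡-Reasoning
    e : Fin (suc m * size) → Fin (suc m) × Carrier
    e = FinPoset.element (chain (suc m) ⊗ R)
    firstRow : ∀ i → e (i ↑ˡ (m * size)) ≡ (zero , element i)
    firstRow i rewrite Fin.splitAt-↑ˡ size i (m * size) = refl
    laterRows : ∀ i → e (size ↑ʳ i) ≡ map₁ suc (FinPoset.element (chain m ⊗ R) i)
    laterRows i rewrite Fin.splitAt-↑ʳ size (m * size) i = refl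

  -- What is left while the lowest row is being processed: `xs` is its undecided part.
  Row : ∀ m → List Carrier → List (Fin (suc m) × Carrier)
  Row m xs = List.map (zero ,_) xs ++ List.map (map₁ suc) (elements (chain m ⊗ R))

  -- One set `U` serves all rows: an element chosen in an earlier row forbids the same elements of
  -- `R` in each later row.
  countIn : ∀ m → (Carrier → Bool) → ℕ → ℕ
  countIn m U = count (leq (chain m ⊗ R)) (U ∘ proj₂) (elements (chain m ⊗ R))

  countIn-cong : ∀ m {U V} → U ≗ V → countIn m U ≗ countIn m V
  countIn-cong m U≗V = count-cong (λ _ _ → refl) (U≗V ∘ proj₂) (elements (chain m ⊗ R))

  countIn-zero : ∀ U → countIn 0 U ≗ (0 C_)
  countIn-zero U zero    = refl
  countIn-zero U (suc i) = refl

  -- Here `P` depends on the row too, because a choice in the lowest row restricts that row by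
  -- incomparability and the later rows by an up set.
  countRow : ∀ m → (Fin (suc m) × Carrier → Bool) → List Carrier → ℕ → ℕ
  countRow m P xs = count (leq (chain (suc m) ⊗ R)) P (Row m xs)

  countIn-suc : ∀ m U → countIn (suc m) U ≗ countRow m (U ∘ proj₂) (elements R)
  countIn-suc m U i = cong (λ xs → count (leq (chain (suc m) ⊗ R)) (U ∘ proj₂) xs i) (elements-suc-⊗ m)

  _∖↑_ : (Carrier → Bool) → Carrier → Carrier → Bool
  (U ∖↑ x) y = U y ∧ not (leq R x y)

  module _ m (P : Fin (suc m) × Carrier → Bool) (U : Carrier → Bool)
           (P-later : ∀ i y → P (suc i , y) ≡ U y) where

    countRow-skip : ∀ {xs} → All (λ x → P (zero , x) ≡ false) xs → countRow m P xs ≗ countIn m U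
    countRow-skip {xs} P-row i = begin
      countRow m P xs i
        ≡⟨ count-skip _ P _ (All.map⁺ P-row) i ⟩
      count (leq (chain (suc m) ⊗ R)) P (List.map (map₁ suc) (elements (chain m ⊗ R))) i
        ≡⟨ count-map _ P _ (elements (chain m ⊗ R)) i ⟩
      count (λ x y → leq (chain (suc m) ⊗ R) (map₁ suc x) (map₁ suc y)) (P ∘ map₁ suc)
            (elements (chain m ⊗ R)) i
        ≡⟨ count-cong (λ x y → cong (_∧ _) (<ᵇ-suc (toℕ (proj₁ x)) (toℕ (proj₁ y))))
             (λ (i , y) → P-later i y) (elements (chain m ⊗ R)) i ⟩
      countIn m U i ∎
      where open ≡-Reasoning

  module _ m (P : Fin (suc m) × Carrier → Bool) (U : Carrier → Bool)
           (P-later : ∀ i y → P (suc i , y) ≡ U y) where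

    -- An element of a later row is never below one of row `zero`, so only the opposite comparison
    -- survives, and it reduces to the order of `R`.
    P-∖↑ : ∀ x i y → P (suc i , y) ∧ incomparable (leq (chain (suc m) ⊗ R)) (zero , x) (suc i , y) ≡ (U ∖↑ x) y
    P-∖↑ x i y = cong₂ _∧_ (P-later i y) (∧-identityʳ _)

    -- Everything listed after the chain in this row lies above each `e c`, so choosing one `e c`
    -- settles the whole row and the count passes to the later rows.
    countRow-chain : ∀ {l} (e : Fin l → Carrier) ys i →
      (∀ {c d} → c Fin.< d → leq R (e c) (e d) ≡ true) →
      (∀ c → All (λ y → leq R (e c) y ≡ true) ys) →
      countRow m P (tabulate e ++ ys) i ≡
      countRow m P ys i + ∑where l (λ c → P (zero , e c)) (λ c → shift (countIn m (U ∖↑ e c)) i)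
    countRow-chain {l} e ys i increasing below = begin
      countRow m P (tabulate e ++ ys) i
        ≡⟨ cong (λ xs → count _≼_ P xs i) row-split ⟩
      count _≼_ P (tabulate ((zero ,_) ∘ e) ++ Row m ys) i
        ≡⟨ count-chain _≼_ P ((zero ,_) ∘ e) (Row m ys) i increasing ⟩
      countRow m P ys i +
      ∑where l (λ c → P (zero , e c)) (λ c → shift (countRow m (λ y → P y ∧ incomparable _≼_ (zero , e c) y) ys) i)
        ≡⟨ cong (countRow m P ys i +_) (∑where-cong l (λ c → P (zero , e c)) λ c _ → shift-cong (skip c) i) ⟩
      countRow m P ys i + ∑where l (λ c → P (zero , e c)) (λ c → shift (countIn m (U ∖↑ e c)) i) ∎
      where
      open ≡-Reasoning
      _≼_ : Fin (suc m) × Carrier → Fin (suc m) × Carrier → Bool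
      _≼_ = leq (chain (suc m) ⊗ R)
      row-split : Row m (tabulate e ++ ys) ≡ tabulate ((zero ,_) ∘ e) ++ Row m ys
      row-split = trans
        (cong (_++ List.map (map₁ suc) (elements (chain m ⊗ R))) (map-++ (zero ,_) (tabulate e) ys))
        (trans (++-assoc (List.map (zero ,_) (tabulate e)) _ _) (cong (_++ Row m ys) (map-tabulate e (zero ,_))))
      skip : ∀ c → countRow m (λ y → P y ∧ incomparable _≼_ (zero , e c) y) ys ≗ countIn m (U ∖↑ e c)
      skip c = countRow-skip m _ (U ∖↑ e c) (P-∖↑ (e c))
        (All.map (λ {y} ec≼y → ∧-falseʳ (P (zero , y))
          (cong (λ b → not b ∧ not (leq R y (e c))) ec≼y)) (below c))

-- Binomial identities

-- Written with `shift`, Pascal's rule covers `k = 0` too: it is multiplication by `1 + x`.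
pascal : ∀ n k → suc n C k ≡ shift (n C_) k + n C k
pascal n zero    = refl
pascal n (suc k) = sym (nCk+nC[k+1]≡[n+1]C[k+1] n k)

shift-pascal : ∀ n k → shift (suc n C_) k ≡ shift (shift (n C_)) k + shift (n C_) k
shift-pascal n k = trans (shift-cong (pascal n) k) (shift-+ _ _ k)

-- Sums over chains

below : ∀ {n} → ℕ → Fin n → Bool
below u c = toℕ c <ᵇ u

∑where-below-0 : ∀ n f → ∑where n (below 0) f ≡ 0
∑where-below-0 zero    f = refl
∑where-below-0 (suc n) f = ∑where-below-0 n (f ∘ suc)

-- Telescoping: `b` is a discrete antiderivative of `g`. Adding `b 0` avoids subtraction, and
-- `u ≤ l` ensures that every index below `u` occurs in `Fin l`.
∑where-below : ∀ (g b : ℕ → ℕ) → (∀ c → b (suc c) ≡ b c + g c) → ∀ {l u} → u ≤ l →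
              ∑where l (below u) (λ c → g (toℕ c)) + b 0 ≡ b u
∑where-below g b step {l}     {zero}  u≤l = cong (_+ b 0) (∑where-below-0 l _)
∑where-below g b step {suc l} {suc u} (s≤s u≤l) = begin
  g 0 + s + b 0    ≡⟨ rearrange (g 0) s (b 0) ⟩
  s + (b 0 + g 0)  ≡⟨ cong (s +_) (step 0) ⟨
  s + b 1          ≡⟨ ∑where-below (g ∘ suc) (b ∘ suc) (step ∘ suc) u≤l ⟩
  b (suc u)        ∎
  where
  open ≡-Reasoning
  s : ℕ
  s = ∑where l (below u) (λ c → g (suc (toℕ c)))
  rearrange : ∀ x y z → x + y + z ≡ y + (z + x)
  rearrange = solve-∀

∑where-binomials : ∀ m {u k} → u ≤ k → ∀ i →
  ∑where k (below u) (λ c → shift (λ j → (m C j) * (toℕ c C j)) i) ≡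
  shift (m C_) i * (u C i)
∑where-binomials m {u} {k} u≤k i = begin
  s             ≡⟨ +-identityʳ s ⟨
  s + 0         ≡⟨ cong (s +_) (initial i) ⟨
  s + b 0       ≡⟨ ∑where-below g b (step i) u≤k ⟩
  b u           ∎
  where
  open ≡-Reasoning
  g b : ℕ → ℕ
  g c = shift (λ j → (m C j) * (c C j)) i
  -- For positive `i` the increment of `c C i` is `c C (i - 1)`, so `b` is an antiderivative of `g`;
  -- at `i = 0` both vanish.
  b c = shift (m C_) i * (c C i)
  s : ℕ
  s = ∑where k (below u) (λ c → g (toℕ c))
  initial : ∀ i → shift (m C_) i * (0 C i) ≡ 0
  initial zero    = refl
  initial (suc i) = *-zeroʳ (m C i)
  step : ∀ i c → shift (m C_) i * (suc c C i) ≡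
                 shift (m C_) i * (c C i) + shift (λ j → (m C j) * (c C j)) i
  step zero    c = refl
  step (suc i) c = trans (cong ((m C i) *_) (pascal c (suc i))) (distrib (m C i) (c C i) (c C suc i))
    where
    distrib : ∀ x y z → x * (y + z) ≡ x * z + x * y
    distrib = solve-∀

-- Initial segments of a chain stay initial segments when the up set of a member `c` is removed.
<ᵇ-∖↑ : ∀ u c y → (c <ᵇ u) ≡ true → ((y <ᵇ u) ∧ not (c ≤ᵇ y)) ≡ (y <ᵇ c)
<ᵇ-∖↑ (suc u) zero    y       c<u = ∧-zeroʳ (y <ᵇ suc u)
<ᵇ-∖↑ (suc u) (suc c) zero    c<u = refl
<ᵇ-∖↑ (suc u) (suc c) (suc y) c<u = trans (cong (λ b → (y <ᵇ u) ∧ not b) (<ᵇ-suc c y)) (<ᵇ-∖↑ u c y c<u)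

<⇒≤ᵇ : ∀ {c d} → c < d → (c ≤ᵇ d) ≡ true
<⇒≤ᵇ {zero}          c<d       = refl
<⇒≤ᵇ {suc c} {suc d} (s≤s c<d) = trans (<ᵇ-suc c d) (<⇒≤ᵇ c<d)

below-all : ∀ {n} (c : Fin n) → below n c ≡ true
below-all zero    = refl
below-all (suc c) = below-all c

-- Products of two chains

module _ (k : ℕ) where

  -- In the lowest row an antichain has no element or a single `c`, which leaves the elements below
  -- `c` for the later rows.
  countIn-chain-suc : ∀ m u i → countIn (chain k) (suc m) (below u) i ≡
    countIn (chain k) m (below u) i +
    ∑where k (below u) (λ c → shift (countIn (chain k) m (below (toℕ c))) i)
  countIn-chain-suc m u i = begin
    countIn (chain k) (suc m) (below u) i
      ≡⟨ countIn-suc (chain k) m (below u) i ⟩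
    countRow (chain k) m (below u ∘ proj₂) (tabulate id) i
      ≡⟨ cong (λ xs → countRow (chain k) m (below u ∘ proj₂) xs i) (++-identityʳ (tabulate id)) ⟨
    countRow (chain k) m (below u ∘ proj₂) (tabulate id ++ []) i
      ≡⟨ countRow-chain (chain k) m (below u ∘ proj₂) (below u) (λ _ _ → refl) id [] i <⇒≤ᵇ (λ _ → []) ⟩
    countRow (chain k) m (below u ∘ proj₂) [] i +
    ∑where k (below u) (λ c → shift (countIn (chain k) m (_∖↑_ (chain k) (below u) c)) i)
      ≡⟨ cong₂ _+_ (countRow-skip (chain k) m _ (below u) (λ _ _ → refl) [] i)
           (∑where-cong k (below u) λ c c<u →
             shift-cong (countIn-cong (chain k) m λ y → <ᵇ-∖↑ u (toℕ c) (toℕ y) c<u) i) ⟩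
    countIn (chain k) m (below u) i +
    ∑where k (below u) (λ c → shift (countIn (chain k) m (below (toℕ c))) i) ∎
    where open ≡-Reasoning

  -- The two cases contribute `m C i` and `m C (i - 1)`, each times `u C i`, and Pascal's rule in
  -- `m` merges them.
  countIn-chain : ∀ m {u} → u ≤ k → ∀ i → countIn (chain k) m (below u) i ≡ (m C i) * (u C i)
  countIn-chain zero    u≤k zero    = refl
  countIn-chain zero    u≤k (suc i) = refl
  countIn-chain (suc m) {u} u≤k i = begin
    countIn (chain k) (suc m) (below u) i
      ≡⟨ countIn-chain-suc m u i ⟩
    countIn (chain k) m (below u) i + ∑where k (below u) (λ c → shift (countIn (chain k) m (below (toℕ c))) i)
      ≡⟨ cong₂ _+_ (countIn-chain m u≤k i)
           (∑where-cong k (below u) λ c _ → shift-cong (countIn-chain m (Fin.toℕ≤n c)) i) ⟩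
    (m C i) * (u C i) + ∑where k (below u) (λ c → shift (λ j → (m C j) * (toℕ c C j)) i)
      ≡⟨ cong ((m C i) * (u C i) +_) (∑where-binomials m u≤k i) ⟩
    (m C i) * (u C i) + shift (m C_) i * (u C i)
      ≡⟨ factor (m C i) (shift (m C_) i) (u C i) ⟩
    (shift (m C_) i + m C i) * (u C i)
      ≡⟨ cong (_* (u C i)) (pascal m i) ⟨
    (suc m C i) * (u C i) ∎
    where
    open ≡-Reasoning
    factor : ∀ a b c → a * c + b * c ≡ (b + a) * c
    factor = solve-∀

-- Products of a chain with `K n`

module _ (n : ℕ) where

  private
    Elt : Set
    Elt = FinPoset.Carrier (K n)

    bottom top : Fin n → Elt
    bottom = inj₁
    top    = inj₂ ∘ inj₂

    left right : Elt
    left  = inj₂ (inj₁ (inj₁ zero))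
    right = inj₂ (inj₁ (inj₂ zero))

    tops : List Elt
    tops = tabulate top

  -- In this order all entries after the bottoms lie above every bottom, as `countRow-chain`
  -- requires.
  elements-K : elements (K n) ≡ tabulate bottom ++ left ∷ right ∷ tops
  elements-K = begin
    elements (K n)
      ≡⟨ elements-⊕ (chain n) ((chain 1 ⊔ chain 1) ⊕ chain n) ⟩
    List.map inj₁ (tabulate id) ++ List.map inj₂ (elements ((chain 1 ⊔ chain 1) ⊕ chain n))
      ≡⟨ cong₂ (λ xs ys → xs ++ List.map inj₂ ys) (map-tabulate id inj₁)
           (elements-⊕ (chain 1 ⊔ chain 1) (chain n)) ⟩
    tabulate bottom ++ left ∷ right ∷ List.map inj₂ (List.map inj₂ (tabulate id))
      ≡⟨ cong (λ xs → tabulate bottom ++ left ∷ right ∷ xs)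
           (trans (cong (List.map inj₂) (map-tabulate id inj₂)) (map-tabulate inj₂ inj₂)) ⟩
    tabulate bottom ++ left ∷ right ∷ tops ∎
    where open ≡-Reasoning

  -- Every down set of K n has this form.
  downSet : ℕ → Bool → Bool → ℕ → Elt → Bool
  downSet u l r t (inj₁ c)               = below u c
  downSet u l r t (inj₂ (inj₁ (inj₁ _))) = l
  downSet u l r t (inj₂ (inj₁ (inj₂ _))) = r
  downSet u l r t (inj₂ (inj₂ c))        = below t c

  private
    countK : ℕ → ℕ → Bool → Bool → ℕ → ℕ → ℕ
    countK m u l r t = countIn (K n) m (downSet u l r t)

  module _ (u : ℕ) (l r : Bool) (t : ℕ) where

    private
      U : Elt → Bool
      U = downSet u l r t

      infixl 5 _∖_
      _∖_ : (Elt → Bool) → Elt → Elt → Bool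
      _∖_ = _∖↑_ (K n)

    -- This and the next three identities show that removing a principal up set keeps the shape
    -- `downSet`. A middle element removes all tops but spares the other middle.
    ∖-bottom : ∀ c → below u c ≡ true → U ∖ bottom c ≗ downSet (toℕ c) false false 0
    ∖-bottom c c<u (inj₁ y)               = <ᵇ-∖↑ u (toℕ c) (toℕ y) c<u
    ∖-bottom c c<u (inj₂ (inj₁ (inj₁ _))) = ∧-zeroʳ l
    ∖-bottom c c<u (inj₂ (inj₁ (inj₂ _))) = ∧-zeroʳ r
    ∖-bottom c c<u (inj₂ (inj₂ y))        = ∧-zeroʳ (below t y)

    ∖-left : U ∖ left ≗ downSet u false r 0
    ∖-left (inj₁ y)                  = ∧-identityʳ _
    ∖-left (inj₂ (inj₁ (inj₁ zero))) = ∧-zeroʳ l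
    ∖-left (inj₂ (inj₁ (inj₂ zero))) = ∧-identityʳ r
    ∖-left (inj₂ (inj₂ y))           = ∧-zeroʳ (below t y)

    ∖-right : U ∖ right ≗ downSet u l false 0
    ∖-right (inj₁ y)                  = ∧-identityʳ _
    ∖-right (inj₂ (inj₁ (inj₁ zero))) = ∧-identityʳ l
    ∖-right (inj₂ (inj₁ (inj₂ zero))) = ∧-zeroʳ r
    ∖-right (inj₂ (inj₂ y))           = ∧-zeroʳ (below t y)

    ∖-top : ∀ c → below t c ≡ true → U ∖ top c ≗ downSet u l r (toℕ c)
    ∖-top c c<t (inj₁ y)               = ∧-identityʳ _
    ∖-top c c<t (inj₂ (inj₁ (inj₁ _))) = ∧-identityʳ l
    ∖-top c c<t (inj₂ (inj₁ (inj₂ _))) = ∧-identityʳ r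
    ∖-top c c<t (inj₂ (inj₂ y))        = <ᵇ-∖↑ t (toℕ c) (toℕ y) c<t

  -- An antichain meets the lowest row in the empty set, one top, `right` alone, `left` with or
  -- without `right`, or one bottom; the summands follow this order. The two middles form the only
  -- antichain of size two in `K n`, hence the single nested `shift`.
  countIn-K-suc : ∀ m u l r t i → countK (suc m) u l r t i ≡
    countK m u l r t i + ∑where n (below t) (λ c → shift (countK m u l r (toℕ c)) i) +
    (if r then shift (countK m u l false 0) i else 0) +
    (if l then shift (λ j → countK m u false r 0 j + (if r then shift (countK m u false false 0) j else 0)) i else 0) +
    ∑where n (below u) (λ c → shift (countK m (toℕ c) false false 0) i)
  countIn-K-suc m u l r t i = begin
    countK (suc m) u l r t i
      ≡⟨ countIn-suc (K n) m U i ⟩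
    countRow (K n) m P (elements (K n)) i
      ≡⟨ cong (λ xs → countRow (K n) m P xs i) elements-K ⟩
    countRow (K n) m P (tabulate bottom ++ left ∷ right ∷ tops) i
      ≡⟨ countRow-chain (K n) m P U (λ _ _ → refl) bottom (left ∷ right ∷ tops) i <⇒≤ᵇ
           (λ c → refl ∷ refl ∷ All.tabulate⁺ λ _ → refl) ⟩
    countRow (K n) m P (left ∷ right ∷ tops) i +
    ∑where n (below u) (λ c → shift (countIn (K n) m (_∖↑_ (K n) U (bottom c))) i)
      ≡⟨ cong₂ _+_
           (cong₂ _+_
             (cong₂ _+_ with-neither (if-cong r λ _ → shift-cong with-right i))
             (if-cong l λ _ → shift-cong with-left i))
           (∑where-cong n (below u) λ c c<u → shift-cong (countIn-cong (K n) m (∖-bottom u l r t c c<u)) i) ⟩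
    countK m u l r t i + ∑where n (below t) (λ c → shift (countK m u l r (toℕ c)) i) +
    (if r then shift (countK m u l false 0) i else 0) +
    (if l then shift (λ j → countK m u false r 0 j + (if r then shift (countK m u false false 0) j else 0)) i else 0) +
    ∑where n (below u) (λ c → shift (countK m (toℕ c) false false 0) i) ∎
    where
    open ≡-Reasoning
    U : Elt → Bool
    U = downSet u l r t
    P P-left P-right P-both : Fin (suc m) × Elt → Bool
    P = U ∘ proj₂
    P-left  y = P y ∧ incomparable (leq (chain (suc m) ⊗ K n)) (zero , left) y
    P-right y = P y ∧ incomparable (leq (chain (suc m) ⊗ K n)) (zero , right) y
    P-both  y = P-left y ∧ incomparable (leq (chain (suc m) ⊗ K n)) (zero , right) y
    P-left-later : ∀ i y → P-left (suc i , y) ≡ downSet u false r 0 y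
    P-left-later i y = trans (P-∖↑ (K n) m P U (λ _ _ → refl) left i y) (∖-left u l r t y)
    P-right-later : ∀ i y → P-right (suc i , y) ≡ downSet u l false 0 y
    P-right-later i y = trans (P-∖↑ (K n) m P U (λ _ _ → refl) right i y) (∖-right u l r t y)
    P-both-later : ∀ i y → P-both (suc i , y) ≡ downSet u false false 0 y
    P-both-later i y = trans (P-∖↑ (K n) m P-left (downSet u false r 0) P-left-later right i y)
                             (∖-right u false r 0 y)
    with-neither : countRow (K n) m P tops i ≡
                   countK m u l r t i + ∑where n (below t) (λ c → shift (countK m u l r (toℕ c)) i)
    with-neither = begin
      countRow (K n) m P tops i
        ≡⟨ cong (λ xs → countRow (K n) m P xs i) (++-identityʳ tops) ⟨
      countRow (K n) m P (tops ++ []) i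
        ≡⟨ countRow-chain (K n) m P U (λ _ _ → refl) top [] i <⇒≤ᵇ (λ _ → []) ⟩
      countRow (K n) m P [] i + ∑where n (below t) (λ c → shift (countIn (K n) m (_∖↑_ (K n) U (top c))) i)
        ≡⟨ cong₂ _+_ (countRow-skip (K n) m P U (λ _ _ → refl) [] i)
             (∑where-cong n (below t) λ c c<t → shift-cong (countIn-cong (K n) m (∖-top u l r t c c<t)) i) ⟩
      countK m u l r t i + ∑where n (below t) (λ c → shift (countK m u l r (toℕ c)) i) ∎
    with-right : countRow (K n) m P-right tops ≗ countK m u l false 0
    with-right = countRow-skip (K n) m P-right _ P-right-later (All.tabulate⁺ {f = top} λ c → ∧-zeroʳ (below t c))
    with-left : ∀ j → countRow (K n) m P-left (right ∷ tops) j ≡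
                      countK m u false r 0 j + (if r then shift (countK m u false false 0) j else 0)
    with-left j = cong₂ _+_
      (countRow-skip (K n) m P-left _ P-left-later (All.tabulate⁺ {f = top} λ c → ∧-zeroʳ (below t c)) j)
      -- `right` is incomparable with `left`, so `P-left` evaluates there to `r ∧ true`.
      (trans (cong (λ b → if b then shift (countRow (K n) m P-both tops) j else 0) (∧-identityʳ r))
        (if-cong r λ _ → shift-cong (countRow-skip (K n) m P-both _ P-both-later
          (All.tabulate⁺ {f = top} λ c → ∧-zeroʳ (below t c ∧ false))) j))

  -- Declared ahead of its proof because of a mutual induction: it uses `countIn-bottom` at the same
  -- `m`, which at `suc m` uses this sum at `m`.
  ∑bottoms : ∀ m {u} → u ≤ n → ∀ i →
    ∑where n (below u) (λ c → shift (countK m (toℕ c) false false 0) i) ≡ shift (m C_) i * (u C i)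

  -- Without middles and tops the allowed set is a chain of `u` elements, hence the formula for two
  -- chains.
  countIn-bottom : ∀ m {u} → u ≤ n → ∀ i → countK m u false false 0 i ≡ (m C i) * (u C i)
  countIn-bottom zero    u≤n zero    = refl
  countIn-bottom zero    u≤n (suc i) = refl
  countIn-bottom (suc m) {u} u≤n i = begin
    countK (suc m) u false false 0 i
      ≡⟨ countIn-K-suc m u false false 0 i ⟩
    countK m u false false 0 i + ∑where n (below 0) _ + 0 + 0 +
    ∑where n (below u) (λ c → shift (countK m (toℕ c) false false 0) i)
      ≡⟨ cong₂ (λ x y → x + y + 0 + 0 + ∑where n (below u) (λ c → shift (countK m (toℕ c) false false 0) i))
           (countIn-bottom m u≤n i) (∑where-below-0 n _) ⟩
    (m C i) * (u C i) + 0 + 0 + 0 + ∑where n (below u) (λ c → shift (countK m (toℕ c) false false 0) i)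
      ≡⟨ cong ((m C i) * (u C i) + 0 + 0 + 0 +_) (∑bottoms m u≤n i) ⟩
    (m C i) * (u C i) + 0 + 0 + 0 + shift (m C_) i * (u C i)
      ≡⟨ factor (m C i) (shift (m C_) i) (u C i) ⟩
    (shift (m C_) i + m C i) * (u C i)
      ≡⟨ cong (_* (u C i)) (pascal m i) ⟨
    (suc m C i) * (u C i) ∎
    where
    open ≡-Reasoning
    factor : ∀ a b c → a * c + 0 + 0 + 0 + b * c ≡ (b + a) * c
    factor = solve-∀

  ∑bottoms m {u} u≤n i = trans
    (∑where-cong n (below u) λ c _ → shift-cong (countIn-bottom m (Fin.toℕ≤n c)) i)
    (∑where-binomials m u≤n i)

  -- The `n` bottoms and a single middle form a chain of `n + 1` elements; `b` selects `left` or
  -- `right`.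
  countIn-oneMiddle : ∀ m b i → countK m n b (not b) 0 i ≡ (m C i) * (suc n C i)
  countIn-oneMiddle zero    b zero    = refl
  countIn-oneMiddle zero    b (suc i) = refl
  countIn-oneMiddle (suc m) b i = begin
    countK (suc m) n b (not b) 0 i
      ≡⟨ expand b ⟩
    countK m n b (not b) 0 i + shift (countK m n false false 0) i + Σ
      ≡⟨ cong₂ _+_ (cong₂ _+_ (countIn-oneMiddle m b i)
           (trans (shift-cong (countIn-bottom m ≤-refl) i) (shift-* (m C_) (n C_) i))) (∑bottoms m ≤-refl i) ⟩
    (m C i) * (suc n C i) + shift (m C_) i * shift (n C_) i + shift (m C_) i * (n C i)
      ≡⟨ cong (λ x → (m C i) * x + shift (m C_) i * shift (n C_) i + shift (m C_) i * (n C i)) (pascal n i) ⟩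
    (m C i) * (shift (n C_) i + n C i) + shift (m C_) i * shift (n C_) i + shift (m C_) i * (n C i)
      ≡⟨ factor (m C i) (shift (m C_) i) (n C i) (shift (n C_) i) ⟩
    (shift (m C_) i + m C i) * (shift (n C_) i + n C i)
      ≡⟨ cong₂ _*_ (pascal m i) (pascal n i) ⟨
    (suc m C i) * (suc n C i) ∎
    where
    open ≡-Reasoning
    Σ : ℕ
    Σ = ∑where n (below n) (λ c → shift (countK m (toℕ c) false false 0) i)
    factor : ∀ a₀ a₁ b₀ b₁ → a₀ * (b₁ + b₀) + a₁ * b₁ + a₁ * b₀ ≡ (a₁ + a₀) * (b₁ + b₀)
    factor = solve-∀
    simplify-left : ∀ x y z → x + 0 + 0 + y + z ≡ x + y + z
    simplify-left = solve-∀
    simplify-right : ∀ x y z → x + 0 + y + 0 + z ≡ x + y + z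
    simplify-right = solve-∀
    expand : ∀ b → countK (suc m) n b (not b) 0 i ≡ countK m n b (not b) 0 i + shift (countK m n false false 0) i + Σ
    expand true  = trans (countIn-K-suc m n true false 0 i)
      (trans (cong₂ (λ x y → countK m n true false 0 i + x + 0 + y + Σ) (∑where-below-0 n _)
               (shift-cong (λ j → +-identityʳ _) i))
        (simplify-left (countK m n true false 0 i) (shift (countK m n false false 0) i) Σ))
    expand false = trans (countIn-K-suc m n false true 0 i)
      (trans (cong (λ x → countK m n false true 0 i + x + shift (countK m n false false 0) i + 0 + Σ) (∑where-below-0 n _))
        (simplify-right (countK m n false true 0 i) (shift (countK m n false false 0) i) Σ))

  -- Comparing with the chain in which left lies below right: the first summand is the count for
  -- that chain, and the second counts the antichains containing both (a , left) and (b , right)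
  -- with a ≤ b, where a < b gives m C i choices of rows and a = b gives m C (i - 1).
  countIn-bothMiddles : ∀ m {t} → t ≤ n → ∀ i → countK m n true true t i ≡
    (m C i) * (suc (suc (t + n)) C i) + (suc m C i) * shift (shift ((t + n) C_)) i
  -- Without rows the second summand vanishes: the double `shift` is `0` at indices 0 and 1, and
  -- `1 C i` is `0` from 2 on.
  countIn-bothMiddles zero    t≤n zero          = refl
  countIn-bothMiddles zero    t≤n (suc zero)    = refl
  countIn-bothMiddles zero    t≤n (suc (suc i)) = refl
  countIn-bothMiddles (suc m) {t} t≤n i = begin
    countK (suc m) n true true t i
      ≡⟨ countIn-K-suc m n true true t i ⟩
    countK m n true true t i + ∑where n (below t) (λ c → shift (countK m n true true (toℕ c)) i) +
    shift (countK m n true false 0) i +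
    shift (λ j → countK m n false true 0 j + shift (countK m n false false 0) j) i +
    ∑where n (below n) (λ c → shift (countK m (toℕ c) false false 0) i)
      ≡⟨ cong₂ _+_ (cong₂ _+_ (cong₂ _+_ (cong₂ _+_
           (countIn-bothMiddles m t≤n i)
           (∑where-cong n (below t) λ c _ → shift-cong (countIn-bothMiddles m (Fin.toℕ≤n c)) i))
           (oneMiddle true))
           (trans (shift-+ _ _ i) (cong₂ _+_ (oneMiddle false)
             (shift-cong (shift-cong (countIn-bottom m ≤-refl)) i))))
           (∑bottoms m ≤-refl i) ⟩
    a₀ * e t + (suc m C i) * d t + Σ + a₁ * shift (suc n C_) i + 
    (a₁ * shift (suc n C_) i + shift (shift (λ j → (m C j) * (n C j))) i) + a₁ * b₀
      ≡⟨ cong₂ (λ x y → a₀ * e t + (suc m C i) * d t + Σ + a₁ * x + (a₁ * x + y) + a₁ * b₀)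
           (shift-pascal n i)
           (trans (shift-cong (shift-* (m C_) (n C_)) i) (shift-* _ _ i)) ⟩
    a₀ * e t + (suc m C i) * d t + Σ + a₁ * (b₂ + b₁) + (a₁ * (b₂ + b₁) + a₂ * b₂) + a₁ * b₀
      ≡⟨ collect (a₀ * e t + (suc m C i) * d t) Σ a₁ a₂ b₀ b₁ b₂ ⟩
    a₀ * e t + (suc m C i) * d t + (Σ + (a₁ * ((b₂ + b₁) + (b₁ + b₀)) + (a₂ + a₁) * b₂))
      -- The contributions of the middles and the bottoms add up to `b 0`, exactly the initial value
      -- that the telescoping sum over the tops needs.
      ≡⟨ cong₂ (λ x y → a₀ * e t + (suc m C i) * d t + (Σ + (a₁ * x + y * b₂)))
           (trans (pascal (suc n) i) (cong₂ _+_ (shift-pascal n i) (pascal n i)))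
           (shift-pascal m i) ⟨
    a₀ * e t + (suc m C i) * d t + (Σ + b 0)
      ≡⟨ cong (a₀ * e t + (suc m C i) * d t +_) (∑where-below g b step t≤n) ⟩
    a₀ * e t + (suc m C i) * d t + (a₁ * e t + s₁ * d t)
      ≡⟨ factor a₀ a₁ (suc m C i) s₁ (e t) (d t) ⟩
    (a₁ + a₀) * e t + (s₁ + (suc m C i)) * d t
      ≡⟨ cong₂ (λ x y → x * e t + y * d t) (pascal m i) (pascal (suc m) i) ⟨
    (suc m C i) * e t + (suc (suc m) C i) * d t ∎
    where
    open ≡-Reasoning
    a₀ a₁ a₂ s₁ b₀ b₁ b₂ : ℕ
    a₀ = m C i
    a₁ = shift (m C_) i
    a₂ = shift (shift (m C_)) i
    s₁ = shift (suc m C_) i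
    b₀ = n C i
    b₁ = shift (n C_) i
    b₂ = shift (shift (n C_)) i
    e d g b : ℕ → ℕ
    e c = suc (suc (c + n)) C i
    d c = shift (shift ((c + n) C_)) i
    g c = shift (λ j → (m C j) * (suc (suc (c + n)) C j) + (suc m C j) * shift (shift ((c + n) C_)) j) i
    Σ : ℕ
    Σ = ∑where n (below t) (λ c → g (toℕ c))
    oneMiddle : ∀ l → shift (countK m n l (not l) 0) i ≡ a₁ * shift (suc n C_) i
    oneMiddle l = trans (shift-cong (countIn-oneMiddle m l) i) (shift-* (m C_) (suc n C_) i)
    -- An antiderivative of `g`: by Pascal's rule, passing from `c` to `suc c` adds to `e c` and
    -- `d c` the same binomials with lower index reduced by one.
    b c = a₁ * e c + s₁ * d c
    step : ∀ c → b (suc c) ≡ b c + g c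
    step c = begin
      a₁ * (suc (suc (suc (c + n))) C i) + s₁ * shift (shift (suc (c + n) C_)) i
        ≡⟨ cong₂ (λ x y → a₁ * x + s₁ * y) (pascal (suc (suc (c + n))) i)
             (trans (shift-cong (shift-pascal (c + n)) i) (shift-+ _ _ i)) ⟩
      a₁ * (e₁ + e c) + s₁ * (d₁ + d c)
        ≡⟨ distrib a₁ s₁ (e c) e₁ (d c) d₁ ⟩
      b c + (a₁ * e₁ + s₁ * d₁)
        ≡⟨ cong (b c +_) (trans (shift-+ _ _ i) (cong₂ _+_ (shift-* _ _ i) (shift-* _ _ i))) ⟨
      b c + g c ∎
      where
      e₁ d₁ : ℕ
      e₁ = shift (suc (suc (c + n)) C_) i
      d₁ = shift (shift (shift ((c + n) C_))) i
      distrib : ∀ a s e e′ d d′ → a * (e′ + e) + s * (d′ + d) ≡ a * e + s * d + (a * e′ + s * d′)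
      distrib = solve-∀
    collect : ∀ x y a₁ a₂ b₀ b₁ b₂ →
      x + y + a₁ * (b₂ + b₁) + (a₁ * (b₂ + b₁) + a₂ * b₂) + a₁ * b₀ ≡
      x + (y + (a₁ * ((b₂ + b₁) + (b₁ + b₀)) + (a₂ + a₁) * b₂))
    collect = solve-∀
    factor : ∀ a₀ a₁ s₀ s₁ e d → a₀ * e + s₀ * d + (a₁ * e + s₁ * d) ≡ (a₁ + a₀) * e + (s₁ + s₀) * d
    factor = solve-∀

-- Coefficients of CatB and CatD

-- Since `a` vanishes from `n` on, truncating the sum at `n` loses no coefficient.
coeff-∑-upTo : ∀ (a : ℕ → ℕ) n → (∀ {k} → n ≤ k → a k ≡ 0) →
            ∀ k → coeff (∑ (upTo n) λ i → a i ·x^ i) k ≡ a k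
coeff-∑-upTo a n vanish k = begin
  coeff (∑ (upTo n) λ i → a i ·x^ i) k           ≡⟨ coeff-∑ (upTo n) _ k ⟩
  sum (List.map (λ i → coeff (a i ·x^ i) k) (upTo n))  ≡⟨ cong sum (map-upTo _ n) ⟩
  sum (applyUpTo (λ i → coeff (a i ·x^ i) k) n)   ≡⟨ diagonal a n vanish k ⟩
  a k                                            ∎
  where
  open ≡-Reasoning
  zeros : ∀ n → sum (applyUpTo (λ _ → 0) n) ≡ 0
  zeros zero    = refl
  zeros (suc n) = zeros n
  diagonal : ∀ (a : ℕ → ℕ) n → (∀ {k} → n ≤ k → a k ≡ 0) →
             ∀ k → sum (applyUpTo (λ i → coeff (a i ·x^ i) k) n) ≡ a k
  diagonal a zero    vanish k       = sym (vanish z≤n)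
  diagonal a (suc n) vanish zero    = trans (cong (a 0 +_) (zeros n)) (+-identityʳ _)
  diagonal a (suc n) vanish (suc k) = diagonal (a ∘ suc) n (vanish ∘ s≤s) k

coeff-CatB : ∀ n i → coeff (CatB n) i ≡ (n C i) * (n C i)
coeff-CatB n i = trans
  (coeff-∑-upTo (λ i → (n C i) ^ 2) (suc n) (λ n<k → cong (_^ 2) (k>n⇒nCk≡0 n<k)) i)
  (cong ((n C i) *_) (*-identityʳ _))

-- The double `shift` encodes the lower index `i - 2` together with the convention that the binomial
-- is `0` for `i < 2`.
coeff-CatD : ∀ N i → coeff (CatD N) i ≡ (N C i) * ((N ∸ 1) C i + shift (shift ((N ∸ 2) C_)) i)
coeff-CatD N i = trans
  (coeff-∑-upTo (λ i → (N C i) * ((N ∸ 1) C i + binom (N ∸ 2) (i ⊖ 2))) (suc N)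
    (λ {k} N<k → cong (_* ((N ∸ 1) C k + binom (N ∸ 2) (k ⊖ 2))) (k>n⇒nCk≡0 N<k)) i)
  (cong (λ x → (N C i) * ((N ∸ 1) C i + x)) (binom-⊖2 i))
  where
  binom-⊖2 : ∀ i → binom (N ∸ 2) (i ⊖ 2) ≡ shift (shift ((N ∸ 2) C_)) i
  binom-⊖2 zero          = refl
  binom-⊖2 (suc zero)    = refl
  binom-⊖2 (suc (suc i)) = refl

-- Antichain polynomials of the two products

𝒩-chain⊗chain : ∀ m n i → coeff (𝒩 (chain m ⊗ chain n)) i ≡ (m C i) * (n C i)
𝒩-chain⊗chain m n i = begin
  coeff (𝒩 (chain m ⊗ chain n)) i         ≡⟨ coeff-𝒩 (chain m ⊗ chain n) i ⟩
  countIn (chain n) m (const true) i       ≡⟨ countIn-cong (chain n) m below-all i ⟨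
  countIn (chain n) m (below n) i          ≡⟨ countIn-chain n m ≤-refl i ⟩
  (m C i) * (n C i)                        ∎
  where open ≡-Reasoning

𝒩-chain⊗K : ∀ m n i → coeff (𝒩 (chain m ⊗ K n)) i ≡
  (m C i) * (suc (suc (n + n)) C i) + (suc m C i) * shift (shift ((n + n) C_)) i
𝒩-chain⊗K m n i = begin
  coeff (𝒩 (chain m ⊗ K n)) i                     ≡⟨ coeff-𝒩 (chain m ⊗ K n) i ⟩
  countIn (K n) m (const true) i                   ≡⟨ countIn-cong (K n) m downSet-all i ⟨
  countIn (K n) m (downSet n n true true n) i      ≡⟨ countIn-bothMiddles n m ≤-refl i ⟩
  (m C i) * (suc (suc (n + n)) C i) + (suc m C i) * shift (shift ((n + n) C_)) i ∎
  where
  open ≡-Reasoning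
  downSet-all : downSet n n true true n ≗ const true
  downSet-all (inj₁ c)               = below-all c
  downSet-all (inj₂ (inj₁ (inj₁ _))) = refl
  downSet-all (inj₂ (inj₁ (inj₂ _))) = refl
  downSet-all (inj₂ (inj₂ c))        = below-all c

mainTheorem3 : (n : ℕ) → 1 ≤ n →
    (𝒩 (chain n ⊗ chain n) ≈ₚ CatB n) ×
    (𝒩 (chain (2 * n + 1) ⊗ K n) ≈ₚ CatD (2 * n + 2))
mainTheorem3 n _ =
  (λ i → trans (𝒩-chain⊗chain n n i) (sym (coeff-CatB n i))) ,
  (λ i → begin
    coeff (𝒩 (chain (2 * n + 1) ⊗ K n)) i
      ≡⟨ cong (λ m → coeff (𝒩 (chain m ⊗ K n)) i) (2n+1 n) ⟩
    coeff (𝒩 (chain (suc (n + n)) ⊗ K n)) i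
      ≡⟨ 𝒩-chain⊗K (suc (n + n)) n i ⟩
    (suc (n + n) C i) * (N C i) + (N C i) * shift (shift ((n + n) C_)) i
      -- With `2n + 1` rows, the number of rows plus one equals `N`, the size of `K n`, so both
      -- summands share the factor `N C i`.
      ≡⟨ factor (suc (n + n) C i) (N C i) (shift (shift ((n + n) C_)) i) ⟩
    (N C i) * (suc (n + n) C i + shift (shift ((n + n) C_)) i)
      ≡⟨ coeff-CatD N i ⟨
    coeff (CatD N) i
      ≡⟨ cong (λ N → coeff (CatD N) i) (2n+2 n) ⟨
    coeff (CatD (2 * n + 2)) i ∎)
  where
  open ≡-Reasoning
  N : ℕ
  N = suc (suc (n + n))
  factor : ∀ x y z → x * y + y * z ≡ y * (x + z)
  factor = solve-∀
  2n+1 : ∀ n → 2 * n + 1 ≡ suc (n + n)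
  2n+1 = solve-∀
  2n+2 : ∀ n → 2 * n + 2 ≡ suc (suc (n + n))
  2n+2 = solve-∀
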